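{- Let $\mathcal{R}$ be a finite triangle-free induced subgraph of the triangular lattice. Then $\mathcal{R}$ is $(a,b)$-choosable for all positive integers $a,b$ with $\tfrac{a}{b}\ge\tfrac52$ (in particular, $\mathcal{R}$ is $(5,2)$-choosable).
   Context: The triangular lattice has vertex set $\mathbb{Z}^2$, with $(x,y)$ adjacent to $(x\pm1,y)$, $(x-1,y+1)$, $(x,y+1)$, $(x,y-1)$, $(x+1,y-1)$. A graph $G$ is $(a,b)$-choosable if for every assignment $L$ of a set $L(v)\subset\mathbb{N}$ with $|L(v)|=a$ to each vertex $v$, there are sets $c(v)\subset L(v)$ with $|c(v)|=b$ and $c(v)\cap c(v')=\emptyset$ for every edge $vv'$. -}

module Defs where

open import Data.Nat using (ℕ)
open import Data.Integer as ℤ using (ℤ; +_; -[1+_]; _-_)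
open import Data.Product using (_×_; _,_; Σ; ∃)
open import Data.Sum using (_⊎_)
open import Data.Empty using (⊥)
open import Data.List using (List; length)
open import Data.List.Membership.Propositional using (_∈_; _∉_)
open import Data.List.Relation.Unary.Unique.Propositional using (Unique)
open import Relation.Binary.PropositionalEquality using (_≡_)

Vertex : Set
Vertex = ℤ × ℤ

Adj : Vertex → Vertex → Set
Adj (x , y) (x' , y') =
  ((x' - x , y' - y) ≡ (+ 1 , + 0)) ⊎
  ((x' - x , y' - y) ≡ (-[1+ 0 ] , + 0)) ⊎
  ((x' - x , y' - y) ≡ (-[1+ 0 ] , + 1)) ⊎
  ((x' - x , y' - y) ≡ (+ 0 , + 1)) ⊎
  ((x' - x , y' - y) ≡ (+ 0 , -[1+ 0 ])) ⊎
  ((x' - x , y' - y) ≡ (+ 1 , -[1+ 0 ]))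

-- A finite induced subgraph of the lattice is given by its (finite) vertex list R;
-- its edges are all lattice edges between vertices of R.
TriangleFree : List Vertex → Set
TriangleFree R = ∀ {u v w} → u ∈ R → v ∈ R → w ∈ R →
  Adj u v → Adj v w → Adj u w → ⊥

IsSetOfSize : ℕ → List ℕ → Set
IsSetOfSize n S = Unique S × length S ≡ n

_⊆_ : List ℕ → List ℕ → Set
S ⊆ T = ∀ {k} → k ∈ S → k ∈ T

Disjoint : List ℕ → List ℕ → Set
Disjoint S T = ∀ {k} → k ∈ S → k ∉ T

Choosable : List Vertex → ℕ → ℕ → Set
Choosable R a b =
  (L : Vertex → List ℕ) → (∀ v → v ∈ R → IsSetOfSize a (L v)) →
  Σ (Vertex → List ℕ) λ c →
    (∀ v → v ∈ R → IsSetOfSize b (c v) × c v ⊆ L v) ×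
    (∀ v v' → v ∈ R → v' ∈ R → Adj v v' → Disjoint (c v) (c v'))

{-# OPTIONS --safe #-}

-- Put height (x , y) = 2 x + y.  A vertex q of maximal height has only three
-- possible neighbours, west, nw and south of it, and west is adjacent to the two
-- others.  So either q has at most one neighbour or its neighbours are exactly
-- nw and south.  In the latter case, starting from the last maximal vertex and
-- going from top vertex to top vertex, one runs along an induced zigzag
-- p 0, q 0, p 1, …, q (k - 1), p k in which the q i have no neighbours off the
-- zigzag and each p i has at most one.  Remove it and colour the rest: with
-- a = 2 b + t and b ≤ 2 t, each p i keeps b + t colours and each q i all its
-- 2 b + t, and the zigzag can be coloured from such lists.  A vertex with at most
-- one neighbour is the case k = 0.
module Submission where

open import Defs
open import Data.Nat as ℕ using (ℕ; zero; suc; _+_; _*_; _∸_; _⊓_; _≤_; _<_; _≥_; z≤n; s≤s; s<s)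
open import Data.Nat.Induction using (Acc; acc; <-wellFounded)
open import Data.Nat.Properties
import Data.Nat.Tactic.RingSolver as ℕ
open import Data.Integer as ℤ using (ℤ; +_; -[1+_]; +[1+_]; ∣_∣; +<+)
import Data.Integer.Properties as ℤ
open import Data.Integer.Tactic.RingSolver using (solve-∀)
open import Data.List using (List; []; _∷_; length; filter; take; _++_)
open import Data.List.Extrema ℤ.≤-totalOrder using (argmax; f[xs]≤f[argmax]; argmax-all)
import Data.List.Extrema ≤-totalOrder as ℕExtrema
open import Data.List.Membership.DecPropositional ℕ._≟_ using (_∈?_; _∉?_)
open import Data.List.Membership.Propositional using (_∈_; _∉_; lose)
open import Data.List.Membership.Propositional.Properties using (∈-filter⁺; ∈-filter⁻; ∈-++⁻)
open import Data.List.Properties using (length-++; length-take; filter-notAll)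
open import Data.List.Relation.Binary.Sublist.Propositional using (lookup)
open import Data.List.Relation.Binary.Sublist.Propositional.Properties using (take-⊆)
open import Data.List.Relation.Unary.All as All using ()
open import Data.List.Relation.Unary.AllPairs using (_∷_)
open import Data.List.Relation.Unary.Any using (here; there)
open import Data.List.Relation.Unary.Unique.Propositional using (Unique)
open import Data.List.Relation.Unary.Unique.Propositional.Properties as Unique using ()
open import Data.Empty using (⊥; ⊥-elim)
open import Data.Product using (_×_; _,_; ∃-syntax; proj₁; proj₂)
open import Data.Product.Properties using (≡-dec)
open import Data.Sum using (_⊎_; inj₁; inj₂; [_,_]′)
open import Function using (_∘_; id)
open import Relation.Binary.Definitions using (DecidableEquality)
open import Relation.Binary.PropositionalEquality
  using (_≡_; refl; sym; trans; cong; cong₂; subst; module ≡-Reasoning)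
open import Relation.Nullary using (¬_; yes; no; contradiction; ¬?; _⊎-dec_)
open import Relation.Nullary.Decidable using (True; toWitness; decidable-stable)
open import Relation.Unary using (Pred; Decidable)

_≟ᵥ_ : DecidableEquality Vertex
_≟ᵥ_ = ≡-dec ℤ._≟_ ℤ._≟_

open import Data.List.Membership.DecPropositional _≟ᵥ_ using ()
  renaming (_∈?_ to _∈ᵥ?_; _∉?_ to _∉ᵥ?_)

private
  variable
    b m n t : ℕ
    S T : List ℕ
    R : List Vertex

-- Lists of colours as sets

-- Binds tighter than _⊆_ of Defs, which has the default precedence 20.
infixl 22 _∩_
infixl 21 _∖_

_∩_ _∖_ : List ℕ → List ℕ → List ℕ
S ∩ T = filter (_∈? T) S
S ∖ T = filter (_∉? T) S

∈-∩⁻ : ∀ {k} → k ∈ S ∩ T → k ∈ S × k ∈ T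
∈-∩⁻ {T = T} = ∈-filter⁻ (_∈? T)

∈-∖⁻ : ∀ {k} → k ∈ S ∖ T → k ∈ S × k ∉ T
∈-∖⁻ {T = T} = ∈-filter⁻ (_∉? T)

∩-unique : ∀ T → Unique S → Unique (S ∩ T)
∩-unique T = Unique.filter⁺ (_∈? T)

∖-unique : ∀ T → Unique S → Unique (S ∖ T)
∖-unique T = Unique.filter⁺ (_∉? T)

∈-take⁻ : ∀ {k} → k ∈ take n S → k ∈ S
∈-take⁻ {n} {S} = lookup (take-⊆ n S)

take-size : Unique S → n ≤ length S → IsSetOfSize n (take n S)
take-size {S} {n} S! n≤∣S∣ =
  Unique.take⁺ n S! , trans (length-take n S) (m≤n⇒m⊓n≡m n≤∣S∣)

length-filter-∁ : ∀ {p} {P : Pred ℕ p} (P? : Decidable P) S →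
  length (filter P? S) + length (filter (¬? ∘ P?) S) ≡ length S
length-filter-∁ P? [] = refl
length-filter-∁ P? (x ∷ S) with P? x
... | yes _ = cong suc (length-filter-∁ P? S)
... | no  _ = trans (+-suc _ _) (cong suc (length-filter-∁ P? S))

-- Pigeonhole by induction on `S`: deleting the head `x` from `T` makes `T` shorter, and the tail of
-- `S` stays inside it because `x` does not recur there.
unique-⊆⇒≤ : Unique S → S ⊆ T → length S ≤ length T
unique-⊆⇒≤ {[]} _ _ = z≤n
unique-⊆⇒≤ {x ∷ S} {T} (x∉S ∷ S!) S⊆T = ≤-trans
  (s≤s (unique-⊆⇒≤ S! λ k∈S →
    ∈-filter⁺ ≢x? (S⊆T (there k∈S)) (All.lookup x∉S k∈S ∘ sym)))
  (filter-notAll ≢x? T (lose (S⊆T (here refl)) λ x≢x → x≢x refl))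
  where
  ≢x? : Decidable (λ k → ¬ (k ≡ x))
  ≢x? k = ¬? (k ℕ.≟ x)

length-∖ : ∀ S T → length (S ∩ T) ≤ n → length S ≤ n + length (S ∖ T)
length-∖ S T ∣S∩T∣≤n =
  ≤-trans (≤-reflexive (sym (length-filter-∁ (_∈? T) S))) (+-monoˡ-≤ _ ∣S∩T∣≤n)

length-∩-≤ʳ : Unique S → length (S ∩ T) ≤ length T
length-∩-≤ʳ {S} {T} S! = unique-⊆⇒≤ (∩-unique T S!) (proj₂ ∘ ∈-∩⁻ {S})

∖-≥ : Unique S → length T ≤ n → n + m ≤ length S → m ≤ length (S ∖ T)
∖-≥ {S} {T} {n} S! ∣T∣≤n n+m≤∣S∣ =
  +-cancelˡ-≤ n _ _ (≤-trans n+m≤∣S∣ (length-∖ S T (≤-trans (length-∩-≤ʳ S!) ∣T∣≤n)))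

-- Greedy choice: take colours satisfying `P` as long as there are any, then fill up to `b` with
-- others. The bound is stated for an arbitrary `X` inside `c` and outside `P`, so that it applies
-- directly to intersections such as `c ∩ D` and `L ∩ d`.
choose-preferring : ∀ {p} {P : Pred ℕ p} (P? : Decidable P) → Unique S →
  b ≤ length S → m ≤ length (filter P? S) →
  ∃[ c ] IsSetOfSize b c × c ⊆ S ×
    (∀ X → Unique X → X ⊆ c → (∀ {k} → k ∈ X → ¬ P k) → length X ≤ b ∸ m)
choose-preferring {S} {b} {m} {P = P} P? S! b≤∣S∣ m≤∣A∣ =
  take b A ++ take (b ∸ length A) B ,
  (Unique.++⁺ (Unique.take⁺ b (Unique.filter⁺ P? S!))
    (Unique.take⁺ _ (Unique.filter⁺ (¬? ∘ P?) S!))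
    (λ (k∈A , k∈B) → ∈B⇒¬P k∈B (∈A⇒P k∈A)) ,
   size) ,
  ([ proj₁ ∘ ∈-filter⁻ P? ∘ ∈-take⁻ {b} , proj₁ ∘ ∈-filter⁻ (¬? ∘ P?) ∘ ∈-take⁻ {b ∸ length A} ]′
    ∘ ∈-++⁻ (take b A)) ,
  few
  where
  A = filter P? S
  B = filter (¬? ∘ P?) S
  ∈A⇒P : ∀ {k} → k ∈ take b A → P k
  ∈A⇒P = proj₂ ∘ ∈-filter⁻ P? {xs = S} ∘ ∈-take⁻ {b}
  ∈B⇒¬P : ∀ {k} → k ∈ take (b ∸ length A) B → ¬ P k
  ∈B⇒¬P = proj₂ ∘ ∈-filter⁻ (¬? ∘ P?) {xs = S} ∘ ∈-take⁻ {b ∸ length A}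
  size : length (take b A ++ take (b ∸ length A) B) ≡ b
  size = begin
    length (take b A ++ take (b ∸ length A) B)      ≡⟨ length-++ (take b A) ⟩
    length (take b A) + length (take (b ∸ length A) B)
      ≡⟨ cong₂ _+_ (trans (length-take b A) (⊓-comm b _))
           (trans (length-take (b ∸ length A) B)
             (m≤n⇒m⊓n≡m (m≤n+o⇒m∸n≤o b (length A)
               (≤-trans b≤∣S∣ (≤-reflexive (sym (length-filter-∁ P? S))))))) ⟩
    length A ⊓ b + (b ∸ length A)                   ≡⟨ m⊓n+n∸m≡n (length A) b ⟩
    b                                               ∎
    where open ≡-Reasoning
  few : ∀ X → Unique X → X ⊆ _ → (∀ {k} → k ∈ X → ¬ P k) → length X ≤ b ∸ m
  few X X! X⊆c X⇒¬P = begin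
    length X                              ≤⟨ unique-⊆⇒≤ X! (λ k∈X →
      [ (λ k∈A → contradiction (∈A⇒P k∈A) (X⇒¬P k∈X)) , id ]′ (∈-++⁻ (take b A) (X⊆c k∈X))) ⟩
    length (take (b ∸ length A) B)        ≡⟨ length-take (b ∸ length A) B ⟩
    (b ∸ length A) ⊓ length B             ≤⟨ m⊓n≤m _ _ ⟩
    b ∸ length A                          ≤⟨ ∸-monoʳ-≤ b m≤∣A∣ ⟩
    b ∸ m                                 ∎
    where open ≤-Reasoning

-- For a = 2b + t the ratio 5/2 means `b ≤ t + t`; the path colouring uses it only through this
-- inequality.
b∸t≤t : b ≤ t + t → b ∸ t ≤ t
b∸t≤t {b} {t} = m≤n+o⇒m∸n≤o b t

-- Colouring a path

-- At least `t` colours of `L` lie outside `D`; preferring them leaves at most `b ∸ t` from `D`.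
end-choice : b ≤ t + t → ∀ {L D} → IsSetOfSize (b + t) L → length D ≤ b →
  ∃[ c ] IsSetOfSize b c × c ⊆ L × length (c ∩ D) ≤ t
end-choice {b} {t} b≤2t {L} {D} (L! , ∣L∣) ∣D∣≤b =
  let c , size , c⊆L , few = choose-preferring (_∉? D) L!
        (≤-trans (m≤m+n b t) (≤-reflexive (sym ∣L∣)))
        (∖-≥ L! ∣D∣≤b (≤-reflexive (sym ∣L∣)))
  in c , size , c⊆L , ≤-trans
       (few (c ∩ D) (∩-unique D (proj₁ size)) (proj₁ ∘ ∈-∩⁻) λ k∈ k∉D → k∉D (proj₂ (∈-∩⁻ {c} k∈)))
       (b∸t≤t b≤2t)

-- `c` and `d` colour two vertices placed in front of one already coloured `c′`. The bound on
-- `c ∩ D` lets the next pair be placed in front of these.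
Prepend : ℕ → ℕ → (L M D c′ : List ℕ) → Set
Prepend b t L M D c′ =
  ∃[ c ] ∃[ d ] (IsSetOfSize b c × c ⊆ L) × (IsSetOfSize b d × d ⊆ M) ×
    Disjoint c d × Disjoint d c′ × length (c ∩ D) ≤ t

-- The constraint "at most t colours from D" on a vertex with list L becomes the
-- constraint "at most t colours from D′" on the vertex two steps further.  Split L
-- into F and G with ∣ F ∣ = b, ∣ G ∣ = t and G outside D.  The middle vertex gives
-- up G, and D′ consists of b of its remaining colours outside F.
transfer : b ≤ t + t → ∀ {L M D} → IsSetOfSize (b + t) L →
  IsSetOfSize (b + (b + t)) M → length D ≤ b →
  ∃[ D′ ] length D′ ≤ b × (∀ c′ → IsSetOfSize b c′ → length (c′ ∩ D′) ≤ t →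
    Prepend b t L M D c′)
transfer {b} {t} b≤2t {L} {M₀} {D} (L! , ∣L∣) (M₀! , ∣M₀∣) ∣D∣≤b =
  D′ , ≤-reflexive ∣D′∣ , colour
  where
  G = take t (L ∖ D)
  G-size : IsSetOfSize t G
  G-size = take-size (∖-unique D L!) (∖-≥ L! ∣D∣≤b (≤-reflexive (sym ∣L∣)))
  ∈G⁻ : ∀ {k} → k ∈ G → k ∈ L × k ∉ D
  ∈G⁻ = ∈-∖⁻ {L} ∘ ∈-take⁻ {t}
  F = L ∖ G
  ∣F∣≤b : length F ≤ b
  ∣F∣≤b = +-cancelˡ-≤ t _ _ (begin
    t + length F                    ≡⟨ cong (_+ length F) (proj₂ G-size) ⟨
    length G + length F             ≤⟨ +-monoˡ-≤ (length F) (unique-⊆⇒≤ (proj₁ G-size)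
                                        λ k∈G → ∈-filter⁺ (_∈? G) (proj₁ (∈G⁻ k∈G)) k∈G) ⟩
    length (L ∩ G) + length F       ≡⟨ length-filter-∁ (_∈? G) L ⟩
    length L                        ≡⟨ ∣L∣ ⟩
    b + t                           ≡⟨ +-comm b t ⟩
    t + b                           ∎)
    where open ≤-Reasoning
  M = M₀ ∖ G
  M! : Unique M
  M! = ∖-unique G M₀!
  2b≤∣M∣ : b + b ≤ length M
  2b≤∣M∣ = ∖-≥ M₀! (≤-reflexive (proj₂ G-size)) (≤-reflexive
    (trans (+-comm t (b + b)) (trans (+-assoc b b t) (sym ∣M₀∣))))
  D′ = take b (M ∖ F)
  D′-size : IsSetOfSize b D′
  D′-size = take-size (∖-unique F M!) (∖-≥ M! ∣F∣≤b 2b≤∣M∣)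
  ∣D′∣ = proj₂ D′-size
  ∈D′⁻ : ∀ {k} → k ∈ D′ → k ∈ M × k ∉ F
  ∈D′⁻ = ∈-∖⁻ {M} ∘ ∈-take⁻ {b}
  colour : ∀ c′ → IsSetOfSize b c′ → length (c′ ∩ D′) ≤ t → Prepend b t L M₀ D c′
  colour c′ (c′! , ∣c′∣) ∣c′∩D′∣≤t =
    c , d , (c-size , λ k∈c → proj₁ (∈-∖⁻ {L} (c⊆ k∈c))) ,
    (d-size , λ k∈d → proj₁ (∈-∖⁻ {M₀} (proj₁ (∈-∖⁻ {M} (d⊆ k∈d))))) ,
    (λ k∈c → proj₂ (∈-∖⁻ {L} (c⊆ k∈c))) ,
    (λ k∈d → proj₂ (∈-∖⁻ {M} (d⊆ k∈d))) ,
    ≤-trans (fewc (c ∩ D) (∩-unique D (proj₁ c-size)) (proj₁ ∘ ∈-∩⁻)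
      λ k∈ k∉D → k∉D (proj₂ (∈-∩⁻ {c} k∈))) (b∸t≤t b≤2t)
    where
    -- `c′` takes at most `t` of the `b` colours of `D′`, so at least `b ∸ t` of them remain for the
    -- middle vertex, and `d` prefers these.
    many : b ∸ t ≤ length ((M ∖ c′) ∩ D′)
    many = ≤-trans
      (m≤n+o⇒m∸n≤o b t (≤-trans (≤-reflexive (sym ∣D′∣)) (length-∖ D′ c′
        (≤-trans (unique-⊆⇒≤ (∩-unique c′ (proj₁ D′-size)) λ k∈ →
            let k∈D′ , k∈c′ = ∈-∩⁻ {D′} k∈ in ∈-filter⁺ (_∈? D′) k∈c′ k∈D′)
          ∣c′∩D′∣≤t))))
      (unique-⊆⇒≤ (∖-unique c′ (proj₁ D′-size)) λ k∈ →
        let k∈D′ , k∉c′ = ∈-∖⁻ {D′} k∈ in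
        ∈-filter⁺ (_∈? D′) (∈-filter⁺ (_∉? c′) (proj₁ (∈D′⁻ k∈D′)) k∉c′) k∈D′)
    dd = choose-preferring (_∈? D′) (∖-unique c′ M!)
      (∖-≥ M! (≤-reflexive ∣c′∣) 2b≤∣M∣) many
    d = proj₁ dd
    d-size = proj₁ (proj₂ dd)
    d⊆ : d ⊆ M ∖ c′
    d⊆ = proj₁ (proj₂ (proj₂ dd))
    fewd = proj₂ (proj₂ (proj₂ dd))
    d∩G : ∀ {k} → k ∈ d → k ∉ G
    d∩G k∈d = proj₂ (∈-∖⁻ {M₀} (proj₁ (∈-∖⁻ {M} (d⊆ k∈d))))
    -- A colour of `L` in `d` avoids `G`, so it lies in `F` and hence outside `D′`. By its
    -- preference `d` has at most `b ∸ (b ∸ t)` such colours.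
    ∣L∩d∣≤t : length (L ∩ d) ≤ t
    ∣L∩d∣≤t = ≤-trans
      (fewd (L ∩ d) (∩-unique d L!) (proj₂ ∘ ∈-∩⁻ {L}) λ k∈ k∈D′ →
        let k∈L , k∈d = ∈-∩⁻ {L} k∈ in
        proj₂ (∈D′⁻ k∈D′) (∈-filter⁺ (_∉? G) k∈L (d∩G k∈d)))
      (m∸[m∸n]≤n b t)
      where
      m∸[m∸n]≤n : ∀ m n → m ∸ (m ∸ n) ≤ n
      m∸[m∸n]≤n m n = m≤n+o⇒m∸n≤o m (m ∸ n) (≤-trans (m≤n+m∸n m n) (≤-reflexive (+-comm n _)))
    -- `L ∖ d` keeps at least `b` colours. Since `d` avoids `G`, all of `G` is among them, which
    -- gives `c` a supply of `t` colours outside `D`.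
    cc = choose-preferring (_∉? D) (∖-unique d L!)
      (+-cancelˡ-≤ t _ _ (≤-trans (≤-reflexive (trans (+-comm t b) (sym ∣L∣)))
        (length-∖ L d ∣L∩d∣≤t)))
      (≤-trans (≤-reflexive (sym (proj₂ G-size))) (unique-⊆⇒≤ (proj₁ G-size) λ k∈G →
        ∈-filter⁺ (_∉? D) (∈-filter⁺ (_∉? d) (proj₁ (∈G⁻ k∈G)) (λ k∈d → d∩G k∈d k∈G))
          (proj₂ (∈G⁻ k∈G))))
    c = proj₁ cc
    c-size = proj₁ (proj₂ cc)
    c⊆ : c ⊆ L ∖ d
    c⊆ = proj₁ (proj₂ (proj₂ cc))
    fewc = proj₂ (proj₂ (proj₂ cc))

record PathColouring (b k : ℕ) (P Q : ℕ → List ℕ) : Set where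
  field
    cp cq : ℕ → List ℕ
    cp-ok : ∀ {i} → i < suc k → IsSetOfSize b (cp i) × cp i ⊆ P i
    cq-ok : ∀ {i} → i < k → IsSetOfSize b (cq i) × cq i ⊆ Q i
    disjˡ : ∀ {i} → i < k → Disjoint (cp i) (cq i)
    disjʳ : ∀ {i} → i < k → Disjoint (cq i) (cp (suc i))

-- The set `D` strengthens the induction. Constraints travel forward and colours backward:
-- `transfer` fixes `D′` for the vertex two steps on before anything is coloured, the shorter path
-- is coloured subject to `D′`, and two vertices are then prepended.
colour-path : b ≤ t + t → ∀ k (P Q : ℕ → List ℕ) {D} → length D ≤ b →
  (∀ {i} → i < suc k → IsSetOfSize (b + t) (P i)) →
  (∀ {i} → i < k → IsSetOfSize (b + (b + t)) (Q i)) →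
  ∃[ C ] length (PathColouring.cp {b} {k} {P} {Q} C 0 ∩ D) ≤ t
colour-path {b} b≤2t zero P Q ∣D∣≤b P-size _ =
  let c , c-size , c⊆ , few = end-choice b≤2t (P-size (s≤s z≤n)) ∣D∣≤b
  in record
    { cp = λ _ → c ; cq = λ _ → []
    ; cp-ok = λ { (s≤s z≤n) → c-size , c⊆ }
    ; cq-ok = λ () ; disjˡ = λ () ; disjʳ = λ () } , few
colour-path {b} b≤2t (suc k) P Q ∣D∣≤b P-size Q-size =
  let D′ , ∣D′∣≤b , colour = transfer b≤2t (P-size (s≤s z≤n)) (Q-size (s≤s z≤n)) ∣D∣≤b
      C , few′ = colour-path b≤2t k (P ∘ suc) (Q ∘ suc) ∣D′∣≤b (P-size ∘ s<s) (Q-size ∘ s<s)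
      open PathColouring C
      c , d , c-ok , d-ok , c#d , d#c′ , few = colour (cp 0) (proj₁ (cp-ok (s≤s z≤n))) few′
  in record
    { cp = λ { zero → c ; (suc i) → cp i }
    ; cq = λ { zero → d ; (suc i) → cq i }
    ; cp-ok = λ { {zero} _ → c-ok ; {suc i} (s≤s i<) → cp-ok i< }
    ; cq-ok = λ { {zero} _ → d-ok ; {suc i} (s≤s i<) → cq-ok i< }
    ; disjˡ = λ { {zero} _ → c#d ; {suc i} (s≤s i<) → disjˡ i< }
    ; disjʳ = λ { {zero} _ → d#c′ ; {suc i} (s≤s i<) → disjʳ i< } } , few

-- The lattice

infixl 6 _⊕_ _⊖_

_⊕_ _⊖_ : Vertex → Vertex → Vertex
(x , y) ⊕ (x′ , y′) = x ℤ.+ x′ , y ℤ.+ y′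
(x , y) ⊖ (x′ , y′) = x ℤ.- x′ , y ℤ.- y′

pattern -1ℤ = -[1+ 0 ]

pattern east  = + 1 , + 0
pattern west  = -1ℤ , + 0
pattern north = + 0 , + 1
pattern south = + 0 , -1ℤ
pattern nw    = -1ℤ , + 1
pattern se    = + 1 , -1ℤ

-- `Adj u v` computes to `Direction (v ⊖ u)`, so adjacency can be transported along equations
-- between differences and decided for concrete ones.
Direction : Vertex → Set
Direction δ = δ ≡ east ⊎ δ ≡ west ⊎ δ ≡ nw ⊎ δ ≡ north ⊎ δ ≡ south ⊎ δ ≡ se

direction? : Decidable Direction
direction? δ = (δ ≟ᵥ _) ⊎-dec (δ ≟ᵥ _) ⊎-dec (δ ≟ᵥ _) ⊎-dec (δ ≟ᵥ _) ⊎-dec (δ ≟ᵥ _) ⊎-dec (δ ≟ᵥ _)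

⊕-assoc : ∀ u v w → u ⊕ v ⊕ w ≡ u ⊕ (v ⊕ w)
⊕-assoc (x , y) (x′ , y′) (x″ , y″) = cong₂ _,_ (ℤ.+-assoc x x′ x″) (ℤ.+-assoc y y′ y″)

⊕-identityʳ : ∀ u → u ⊕ (+ 0 , + 0) ≡ u
⊕-identityʳ u = cong₂ _,_ (ℤ.+-identityʳ _) (ℤ.+-identityʳ _)

⊕-⊖ : ∀ u v → u ⊕ (v ⊖ u) ≡ v
⊕-⊖ (x , y) (x′ , y′) = cong₂ _,_ (eq x x′) (eq y y′)
  where
  eq : ∀ i j → i ℤ.+ (j ℤ.- i) ≡ j
  eq = solve-∀

⊖-translate : ∀ u v w → (u ⊕ w) ⊖ (u ⊕ v) ≡ w ⊖ v
⊖-translate (x , y) (x′ , y′) (x″ , y″) = cong₂ _,_ (eq x x′ x″) (eq y y′ y″)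
  where
  eq : ∀ i j k → (i ℤ.+ k) ℤ.- (i ℤ.+ j) ≡ k ℤ.- j
  eq = solve-∀

⊖-⊕ : ∀ u δ → (u ⊕ δ) ⊖ u ≡ δ
⊖-⊕ (x , y) (x′ , y′) = cong₂ _,_ (eq x x′) (eq y y′)
  where
  eq : ∀ i j → (i ℤ.+ j) ℤ.- i ≡ j
  eq = solve-∀

pattern is-east p  = inj₁ p
pattern is-west p  = inj₂ (inj₁ p)
pattern is-nw p    = inj₂ (inj₂ (inj₁ p))
pattern is-north p = inj₂ (inj₂ (inj₂ (inj₁ p)))
pattern is-south p = inj₂ (inj₂ (inj₂ (inj₂ (inj₁ p))))
pattern is-se p    = inj₂ (inj₂ (inj₂ (inj₂ (inj₂ p))))

Adj-sym : ∀ u v → Adj u v → Adj v u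
Adj-sym (x , y) (x′ , y′) adj = subst Direction (cong₂ _,_ (eq x x′) (eq y y′)) (opposite adj)
  where
  eq : ∀ i j → + 0 ℤ.- (j ℤ.- i) ≡ i ℤ.- j
  eq = solve-∀
  opposite : ∀ {δ} → Direction δ → Direction ((+ 0 , + 0) ⊖ δ)
  opposite (is-east refl)  = is-west refl
  opposite (is-west refl)  = is-east refl
  opposite (is-nw refl)    = is-se refl
  opposite (is-north refl) = is-south refl
  opposite (is-south refl) = is-north refl
  opposite (is-se refl)    = is-nw refl

Adj⇒⊕ : ∀ {u v δ} → v ⊖ u ≡ δ → v ≡ u ⊕ δ
Adj⇒⊕ {u} {v} eq = trans (sym (⊕-⊖ u v)) (cong (u ⊕_) eq)

-- Removing a handle

OnPath : ℕ → (p q : ℕ → Vertex) → Vertex → Set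
OnPath k p q u = (∃[ i ] i < suc k × u ≡ p i) ⊎ (∃[ i ] i < k × u ≡ q i)

onPath? : ∀ k p q → Decidable (OnPath k p q)
onPath? k p q u = anyUpTo? (λ i → u ≟ᵥ p i) (suc k) ⊎-dec anyUpTo? (λ i → u ≟ᵥ q i) k

-- The path p 0, q 0, p 1, …, q (k - 1), p k; off the path, p i may be adjacent to z i only.
record Handle (R : List Vertex) : Set where
  field
    k : ℕ
    p q z : ℕ → Vertex
    p∈R : ∀ {i} → i < suc k → p i ∈ R
    q∈R : ∀ {i} → i < k → q i ∈ R
    pp : ∀ {i j} → i < suc k → j < suc k → ¬ Adj (p i) (p j)
    qq : ∀ {i j} → i < k → j < k → ¬ Adj (q i) (q j)
    pq : ∀ {i j} → i < suc k → j < k → Adj (p i) (q j) → i ≡ j ⊎ i ≡ suc j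
    p-off : ∀ {i u} → i < suc k → u ∈ R → Adj (p i) u → OnPath k p q u ⊎ u ≡ z i
    q-off : ∀ {i u} → i < k → u ∈ R → Adj (q i) u → OnPath k p q u

  rest : List Vertex
  rest = filter (¬? ∘ onPath? k p q) R

  rest-shorter : length rest < length R
  rest-shorter = filter-notAll (¬? ∘ onPath? k p q) R
    (lose (p∈R (s≤s z≤n)) λ off → off (inj₁ (0 , s≤s z≤n , refl)))

  rest⊆R : ∀ {u} → u ∈ rest → u ∈ R
  rest⊆R = proj₁ ∘ ∈-filter⁻ (¬? ∘ onPath? k p q)

extend : ∀ {b t} → b ≤ t + t → (H : Handle R) →
  Choosable (Handle.rest H) (b + (b + t)) b → Choosable R (b + (b + t)) b
extend {R} {b} {t} b≤2t H rest-choosable L L-size = c , c-ok , c-disjoint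
  where
  open Handle H
  restColouring = rest-choosable L (λ v → L-size v ∘ rest⊆R)
  c₀ : Vertex → List ℕ
  c₀ = proj₁ restColouring
  c₀-ok = proj₁ (proj₂ restColouring)
  c₀-disjoint = proj₂ (proj₂ restColouring)

  -- Outside `rest` nothing is known about `c₀`, so the forbidden set is empty there; this keeps its
  -- size at most `b`.
  Z : ℕ → List ℕ
  Z i with z i ∈ᵥ? rest
  ... | yes _ = c₀ (z i)
  ... | no  _ = []

  ∣Z∣≤b : ∀ i → length (Z i) ≤ b
  ∣Z∣≤b i with z i ∈ᵥ? rest
  ... | yes z∈ = ≤-reflexive (proj₂ (proj₁ (c₀-ok (z i) z∈)))
  ... | no  _  = z≤n

  c₀⊆Z : ∀ {i} → z i ∈ rest → c₀ (z i) ⊆ Z i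
  c₀⊆Z {i} z∈ with z i ∈ᵥ? rest
  ... | yes _ = id
  ... | no z∉ = contradiction z∈ z∉

  P Q : ℕ → List ℕ
  -- Cut down to the exact size that `colour-path` asks for.
  P i = take (b + t) (L (p i) ∖ Z i)
  Q i = L (q i)

  P-size : ∀ {i} → i < suc k → IsSetOfSize (b + t) (P i)
  P-size {i} i≤k =
    let L! , ∣L∣ = L-size (p i) (p∈R i≤k)
    in take-size (∖-unique (Z i) L!) (∖-≥ L! (∣Z∣≤b i) (≤-reflexive (sym ∣L∣)))

  ∈P⁻ : ∀ {i x} → x ∈ P i → x ∈ L (p i) × x ∉ Z i
  ∈P⁻ {i} = ∈-∖⁻ {L (p i)} ∘ ∈-take⁻ {b + t}

  -- No vertex precedes `p 0` on the path, so the initial constraint set is empty.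
  path = proj₁ (colour-path b≤2t k P Q {[]} z≤n P-size (λ i<k → L-size _ (q∈R i<k)))
  open PathColouring path

  -- The disjointness facts below hold for all indices in range, so any index that `onPath?` returns
  -- will do.
  c : Vertex → List ℕ
  c u with onPath? k p q u
  ... | yes (inj₁ (i , _)) = cp i
  ... | yes (inj₂ (i , _)) = cq i
  ... | no  _              = c₀ u

  c-ok : ∀ u → u ∈ R → IsSetOfSize b (c u) × c u ⊆ L u
  c-ok u u∈R with onPath? k p q u
  ... | yes (inj₁ (i , i≤k , refl)) =
    proj₁ (cp-ok i≤k) , λ x∈ → proj₁ (∈P⁻ (proj₂ (cp-ok i≤k) x∈))
  ... | yes (inj₂ (i , i<k , refl)) = cq-ok i<k
  ... | no off = c₀-ok u (∈-filter⁺ (¬? ∘ onPath? k p q) u∈R off)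

  cp#cq : ∀ {i j} → i < suc k → j < k → Adj (p i) (q j) → Disjoint (cp i) (cq j)
  cp#cq i≤k j<k adj with pq i≤k j<k adj
  ... | inj₁ refl = disjˡ j<k
  ... | inj₂ refl = λ x∈cp x∈cq → disjʳ j<k x∈cq x∈cp

  cp#c₀ : ∀ {i u} → i < suc k → u ∈ R → ¬ OnPath k p q u → Adj (p i) u → Disjoint (cp i) (c₀ u)
  cp#c₀ i≤k u∈R off adj x∈cp x∈c₀ with p-off i≤k u∈R adj
  ... | inj₁ on   = off on
  ... | inj₂ refl = proj₂ (∈P⁻ (proj₂ (cp-ok i≤k) x∈cp))
                      (c₀⊆Z (∈-filter⁺ (¬? ∘ onPath? k p q) u∈R off) x∈c₀)

  c-disjoint : ∀ u u′ → u ∈ R → u′ ∈ R → Adj u u′ → Disjoint (c u) (c u′)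
  c-disjoint u u′ u∈R u′∈R adj with onPath? k p q u | onPath? k p q u′
  ... | yes (inj₁ (i , i≤k , refl)) | yes (inj₁ (j , j≤k , refl)) = contradiction adj (pp i≤k j≤k)
  ... | yes (inj₁ (i , i≤k , refl)) | yes (inj₂ (j , j<k , refl)) = cp#cq i≤k j<k adj
  ... | yes (inj₁ (i , i≤k , refl)) | no off = cp#c₀ i≤k u′∈R off adj
  ... | yes (inj₂ (i , i<k , refl)) | yes (inj₁ (j , j≤k , refl)) =
    λ x∈ x∈′ → cp#cq j≤k i<k (Adj-sym (q i) (p j) adj) x∈′ x∈
  ... | yes (inj₂ (i , i<k , refl)) | yes (inj₂ (j , j<k , refl)) = contradiction adj (qq i<k j<k)
  ... | yes (inj₂ (i , i<k , refl)) | no off = contradiction (q-off i<k u′∈R adj) off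
  ... | no off | yes (inj₁ (j , j≤k , refl)) =
    λ x∈ x∈′ → cp#c₀ j≤k u∈R off (Adj-sym u (p j) adj) x∈′ x∈
  ... | no off | yes (inj₂ (j , j<k , refl)) =
    contradiction (q-off j<k u∈R (Adj-sym u (q j) adj)) off
  ... | no off | no off′ = c₀-disjoint u u′ (∈-filter⁺ (¬? ∘ onPath? k p q) u∈R off)
                             (∈-filter⁺ (¬? ∘ onPath? k p q) u′∈R off′) adj

-- Finding a handle

module _ (tf : TriangleFree R) where

  -- For concrete `δ` and `ε` the three adjacencies are decided by computation, which fills in the
  -- implicit `True` arguments.
  no-triangle : ∀ u δ ε → {True (direction? δ)} → {True (direction? ε)} →
    {True (direction? (ε ⊖ δ))} →
    u ∈ R → u ⊕ δ ∈ R → u ⊕ ε ∈ R → ⊥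
  no-triangle u δ ε {dδ} {dε} {dε-δ} u∈R uδ∈R uε∈R = tf u∈R uδ∈R uε∈R
    (subst Direction (sym (⊖-⊕ u δ)) (toWitness dδ))
    (subst Direction (sym (⊖-translate u δ ε)) (toWitness dε-δ))
    (subst Direction (sym (⊖-⊕ u ε)) (toWitness dε))

  -- The two neighbours are adjacent to each other, so they cannot both be in `R`. If neither is,
  -- the value of `z` is immaterial.
  at-most-one : ∀ u δ ε → {True (direction? δ)} → {True (direction? ε)} →
    {True (direction? (ε ⊖ δ))} →
    u ∈ R → ∃[ z ] (∀ {w} → w ∈ R → w ≡ u ⊕ δ ⊎ w ≡ u ⊕ ε → w ≡ z)
  at-most-one u δ ε {dδ} {dε} {dε-δ} u∈R with (u ⊕ δ) ∈ᵥ? R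
  ... | yes uδ∈R = u ⊕ δ , λ where
    _   (inj₁ w≡) → w≡
    w∈R (inj₂ refl) → ⊥-elim (no-triangle u δ ε {dδ} {dε} {dε-δ} u∈R uδ∈R w∈R)
  ... | no uδ∉R = u ⊕ ε , λ where
    w∈R (inj₁ refl) → contradiction w∈R uδ∉R
    _   (inj₂ w≡) → w≡

-- Twice the Euclidean coordinate of a vertex in the direction east.
height : Vertex → ℤ
height (x , y) = x ℤ.+ x ℤ.+ y

height-⊕ : ∀ u δ → height (u ⊕ δ) ≡ height u ℤ.+ height δ
height-⊕ (x , y) (x′ , y′) = eq x y x′ y′
  where
  eq : ∀ x y x′ y′ → (x ℤ.+ x′) ℤ.+ (x ℤ.+ x′) ℤ.+ (y ℤ.+ y′) ≡
     (x ℤ.+ x ℤ.+ y) ℤ.+ (x′ ℤ.+ x′ ℤ.+ y′)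
  eq = solve-∀

height-⊖ : ∀ u v → height (v ⊖ u) ≡ height v ℤ.- height u
height-⊖ (x , y) (x′ , y′) = eq x y x′ y′
  where
  eq : ∀ x y x′ y′ → (x′ ℤ.- x) ℤ.+ (x′ ℤ.- x) ℤ.+ (y′ ℤ.- y) ≡
     (x′ ℤ.+ x′ ℤ.+ y′) ℤ.- (x ℤ.+ x ℤ.+ y)
  eq = solve-∀

-- The six directions have heights 2, -2, -1, 1, -1, 1, none of them zero.
same-height⇒¬Adj : ∀ u v → height u ≡ height v → ¬ Adj u v
same-height⇒¬Adj u v h≡ = level (trans (height-⊖ u v) (ℤ.i≡j⇒i-j≡0 (sym h≡)))
  where
  level : ∀ {δ} → height δ ≡ + 0 → ¬ Direction δ
  level () (is-east refl)
  level () (is-west refl)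
  level () (is-nw refl)
  level () (is-north refl)
  level () (is-south refl)
  level () (is-se refl)

least : ∀ {p} {P : Pred ℕ p} → Decidable P → ∀ n → P n → ∃[ k ] P k × (∀ {i} → i < k → ¬ P i)
least P? zero p = 0 , p , λ ()
least P? (suc n) p with P? 0
... | yes p₀ = 0 , p₀ , λ ()
... | no ¬p₀ =
  let k , pk , min = least (P? ∘ suc) n p
  in suc k , pk , λ { {zero} _ → ¬p₀ ; {suc i} (s≤s i<k) → min i<k }

-- The zigzag along the top level

module Zigzag (tf : TriangleFree R) (v : Vertex) (v∈R : v ∈ R)
  (highest : ∀ {u} → u ∈ R → height u ℤ.≤ height v)
  (rightmost : ∀ {u} → u ∈ R → height u ≡ height v → proj₁ u ℤ.≤ proj₁ v) where

  -- The step (-1, 2) has height 0, so all `q i` lie on the top level, with falling first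
  -- coordinate. The `p i` lie one level lower, and `p (suc i)` is both south of `q (suc i)` and nw
  -- of `q i`.
  p q : ℕ → Vertex
  q zero    = v
  q (suc i) = q i ⊕ (-1ℤ , + 2)
  p i = q i ⊕ south

  q-nw : ∀ i → q i ⊕ nw ≡ p (suc i)
  q-nw i = sym (⊕-assoc (q i) _ _)

  p-north : ∀ i → p i ⊕ north ≡ q i
  p-north i = trans (⊕-assoc (q i) _ _) (⊕-identityʳ (q i))

  p-se : ∀ i → p (suc i) ⊕ se ≡ q i
  p-se i = trans (⊕-assoc (q i ⊕ _) _ _) (trans (⊕-assoc (q i) _ _) (⊕-identityʳ (q i)))

  height-q : ∀ i → height (q i) ≡ height v
  height-q zero    = refl
  height-q (suc i) = trans (height-⊕ (q i) _) (trans (ℤ.+-identityʳ _) (height-q i))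

  height-p : ∀ i → height (p i) ≡ height v ℤ.+ -1ℤ
  height-p i = trans (height-⊕ (q i) _) (cong (ℤ._+ -1ℤ) (height-q i))

  x-q : ∀ i → proj₁ (q i) ≡ proj₁ v ℤ.- + i
  x-q zero    = sym (ℤ.+-identityʳ _)
  x-q (suc i) = trans (cong (ℤ._+ -1ℤ) (x-q i)) (eq (proj₁ v) (+ i))
    where
    eq : ∀ x i → x ℤ.- i ℤ.+ -1ℤ ≡ x ℤ.- (+ 1 ℤ.+ i)
    eq = solve-∀

  -- The excess over the top level is written `+[1+ n ]` so that its positivity is visible.
  too-high : ∀ {u} w δ n → u ∈ R → u ≡ w ⊕ δ → height w ℤ.+ height δ ≡ height v ℤ.+ +[1+ n ] → ⊥
  too-high w δ n u∈R refl h≡ = ℤ.<⇒≱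
    (subst (ℤ._< height v ℤ.+ +[1+ n ]) (ℤ.+-identityʳ (height v))
      (ℤ.+-monoʳ-< (height v) (+<+ (s≤s z≤n))))
    (subst (ℤ._≤ height v) (trans (height-⊕ w δ) h≡) (highest u∈R))

  q-neighbours : ∀ {u} i → u ∈ R → Adj (q i) u → u ≡ q i ⊕ south ⊎ u ≡ q i ⊕ nw ⊎ u ≡ q i ⊕ west
  q-neighbours i u∈R (is-east eq)  = ⊥-elim (too-high (q i) east 1 u∈R (Adj⇒⊕ eq)
    (cong (λ h → h ℤ.+ + 2) (height-q i)))
  q-neighbours i u∈R (is-west eq)  = inj₂ (inj₂ (Adj⇒⊕ eq))
  q-neighbours i u∈R (is-nw eq)    = inj₂ (inj₁ (Adj⇒⊕ eq))
  q-neighbours i u∈R (is-north eq) = ⊥-elim (too-high (q i) north 0 u∈R (Adj⇒⊕ eq)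
    (cong (λ h → h ℤ.+ + 1) (height-q i)))
  q-neighbours i u∈R (is-south eq) = inj₁ (Adj⇒⊕ eq)
  q-neighbours i u∈R (is-se eq)    = ⊥-elim (too-high (q i) se 0 u∈R (Adj⇒⊕ eq)
    (cong (λ h → h ℤ.+ + 1) (height-q i)))

  -- From one level below the top only east, of height 2, overshoots.
  p-neighbours : ∀ {u} i → u ∈ R → Adj (p i) u →
    u ≡ p i ⊕ north ⊎ u ≡ p i ⊕ se ⊎ u ≡ p i ⊕ west ⊎ u ≡ p i ⊕ nw ⊎ u ≡ p i ⊕ south
  p-neighbours i u∈R (is-east eq)  = ⊥-elim (too-high (p i) east 0 u∈R (Adj⇒⊕ eq)
    (trans (cong (λ h → h ℤ.+ + 2) (height-p i)) (ℤ.+-assoc (height v) -1ℤ (+ 2))))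
  p-neighbours i u∈R (is-west eq)  = inj₂ (inj₂ (inj₁ (Adj⇒⊕ eq)))
  p-neighbours i u∈R (is-nw eq)    = inj₂ (inj₂ (inj₂ (inj₁ (Adj⇒⊕ eq))))
  p-neighbours i u∈R (is-north eq) = inj₁ (Adj⇒⊕ eq)
  p-neighbours i u∈R (is-south eq) = inj₂ (inj₂ (inj₂ (inj₂ (Adj⇒⊕ eq))))
  p-neighbours i u∈R (is-se eq)    = inj₂ (inj₁ (Adj⇒⊕ eq))

  -- This vertex is `v` shifted by (1, -2): on the top level, but further right than `v`.
  p₀⊕se∉R : p 0 ⊕ se ∉ R
  p₀⊕se∉R u∈R = ℤ.<⇒≱
    (subst (ℤ._< x) (ℤ.+-identityʳ (proj₁ v))
      (subst (proj₁ v ℤ.+ + 0 ℤ.<_) (sym x≡) (ℤ.+-monoʳ-< (proj₁ v) (+<+ (s≤s z≤n)))))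
    (rightmost u∈R (trans (cong height (⊕-assoc v south se))
      (trans (height-⊕ v (south ⊕ se)) (ℤ.+-identityʳ (height v)))))
    where
    x = proj₁ (p 0 ⊕ se)
    x≡ : x ≡ proj₁ v ℤ.+ + 1
    x≡ = ℤ.+-assoc (proj₁ v) (+ 0) (+ 1)

  -- The difference from `p i` to `q j` has height 1, so it is north or se; its first coordinate is
  -- i - j, which is 0 or 1 respectively.
  p-q-index : ∀ i j → Adj (p i) (q j) → i ≡ j ⊎ i ≡ suc j
  p-q-index i j = index
    (trans (cong₂ (λ x x′ → x ℤ.- (x′ ℤ.+ + 0)) (x-q j) (x-q i)) (eqˣ (proj₁ v) (+ i) (+ j)))
    (trans (height-⊖ (p i) (q j)) (trans (cong₂ ℤ._-_ (height-q j) (height-p i)) (eqʰ (height v))))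
    where
    eqˣ : ∀ x i j → x ℤ.- j ℤ.- (x ℤ.- i ℤ.+ + 0) ≡ i ℤ.- j
    eqˣ = solve-∀
    eqʰ : ∀ h → h ℤ.- (h ℤ.+ -1ℤ) ≡ + 1
    eqʰ = solve-∀
    eqˢ : ∀ i j → i ≡ j ℤ.+ (i ℤ.- j)
    eqˢ = solve-∀
    index : ∀ {δ} → proj₁ δ ≡ + i ℤ.- + j → height δ ≡ + 1 → Direction δ → i ≡ j ⊎ i ≡ suc j
    index x≡ h≡ (is-north refl) = inj₁ (ℤ.+-injective (ℤ.i-j≡0⇒i≡j _ _ (sym x≡)))
    index x≡ h≡ (is-se refl) = inj₂ (ℤ.+-injective
      (trans (eqˢ (+ i) (+ j)) (trans (cong (λ d → + j ℤ.+ d) (sym x≡)) (ℤ.+-comm (+ j) (+ 1)))))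
    index x≡ () (is-east refl)
    index x≡ () (is-west refl)
    index x≡ () (is-nw refl)
    index x≡ () (is-south refl)

  leaf-handle : ∀ u → u ∈ R → ∃[ z ] (∀ {w} → w ∈ R → Adj u w → w ≡ z) → Handle R
  leaf-handle u u∈R (z , only-z) = record
    { k = 0 ; p = λ _ → u ; q = λ _ → u ; z = λ _ → z
    ; p∈R = λ _ → u∈R ; q∈R = λ ()
    ; pp = λ _ _ → same-height⇒¬Adj u u refl ; qq = λ () ; pq = λ _ ()
    ; p-off = λ _ w∈R adj → inj₂ (only-z w∈R adj) ; q-off = λ () }

  -- Without south, `q i` has only nw and west left, which are adjacent. In `missing-p-suc` the
  -- remaining pair is south and west, again adjacent.
  missing-p : ∀ i → q i ∈ R → p i ∉ R → Handle R
  missing-p i q∈R p∉R = leaf-handle (q i) q∈R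
    (z , λ w∈R adj → only-z w∈R (q-neighbours i w∈R adj))
    where
    z,only = at-most-one tf (q i) nw west q∈R
    z = proj₁ z,only
    only-z : ∀ {w} → w ∈ R → _ → w ≡ z
    only-z w∈R (inj₁ refl) = contradiction w∈R p∉R
    only-z w∈R (inj₂ w≡) = proj₂ z,only w∈R w≡

  missing-p-suc : ∀ i → q i ∈ R → p (suc i) ∉ R → Handle R
  missing-p-suc i q∈R p∉R = leaf-handle (q i) q∈R
    (z , λ w∈R adj → only-z w∈R (q-neighbours i w∈R adj))
    where
    z,only = at-most-one tf (q i) south west q∈R
    z = proj₁ z,only
    only-z : ∀ {w} → w ∈ R → w ≡ q i ⊕ south ⊎ w ≡ q i ⊕ nw ⊎ w ≡ q i ⊕ west → w ≡ z
    only-z w∈R (inj₁ w≡) = proj₂ z,only w∈R (inj₁ w≡)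
    only-z w∈R (inj₂ (inj₁ refl)) = contradiction (subst (_∈ R) (q-nw i) w∈R) p∉R
    only-z w∈R (inj₂ (inj₂ w≡)) = proj₂ z,only w∈R (inj₂ w≡)

  -- `q (suc k)` is the first gap on the top level. The zigzag has `suc k` vertices `q i` and one
  -- more `p i`, so the `k` of the handle is `suc k` here.
  module _ (k : ℕ) (q∈R : ∀ {i} → i < suc k → q i ∈ R) (q∉R : q (suc k) ∉ R)
    (p∈R : ∀ {i} → i < suc (suc k) → p i ∈ R) where

    q-off : ∀ {i u} → i < suc k → u ∈ R → Adj (q i) u → OnPath (suc k) p q u
    q-off {i} i<k u∈R adj with q-neighbours i u∈R adj
    ... | inj₁ refl        = inj₁ (i , m<n⇒m<1+n i<k , refl)
    ... | inj₂ (inj₁ refl) = inj₁ (suc i , s<s i<k , q-nw i)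
    ... | inj₂ (inj₂ refl) =
      ⊥-elim (no-triangle tf (q i) south west (q∈R i<k) (p∈R (m<n⇒m<1+n i<k)) u∈R)

    -- For an inner `p i`, north and se are on the zigzag; they exclude their neighbours nw and
    -- south, and west remains. At `p 0`, se is missing and north excludes nw, leaving the adjacent
    -- pair west, south. At the last `p i`, north is the gap and se excludes south, leaving the
    -- adjacent pair west, nw. The `z` comes before the bound on `i` because a handle wants a total
    -- function; out of range it is `v`.
    p-off : ∀ i → ∃[ z ] (i < suc (suc k) →
      ∀ {u} → u ∈ R → Adj (p i) u → OnPath (suc k) p q u ⊎ u ≡ z)
    p-off i with i ℕ.<? suc (suc k)
    ... | no i≮ = v , λ i< → contradiction i< i≮
    p-off zero | yes 0<k = z , λ _ u∈R adj → only-z u∈R (p-neighbours 0 u∈R adj)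
      where
      z,only = at-most-one tf (p 0) west south (p∈R 0<k)
      z = proj₁ z,only
      north∈R : p 0 ⊕ north ∈ R
      north∈R = subst (_∈ R) (sym (p-north 0)) v∈R
      only-z : ∀ {u} → u ∈ R → _ → OnPath (suc k) p q u ⊎ u ≡ z
      only-z u∈R (inj₁ refl) = inj₁ (inj₂ (0 , s≤s z≤n , p-north 0))
      only-z u∈R (inj₂ (inj₁ refl)) = contradiction u∈R p₀⊕se∉R
      only-z u∈R (inj₂ (inj₂ (inj₁ u≡))) = inj₂ (proj₂ z,only u∈R (inj₁ u≡))
      only-z u∈R (inj₂ (inj₂ (inj₂ (inj₁ refl)))) =
        ⊥-elim (no-triangle tf (p 0) north nw (p∈R 0<k) north∈R u∈R)
      only-z u∈R (inj₂ (inj₂ (inj₂ (inj₂ u≡)))) = inj₂ (proj₂ z,only u∈R (inj₂ u≡))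
    p-off (suc i) | yes (s≤s i<k) with suc i ℕ.<? suc k
    ... | yes 1+i<k = p (suc i) ⊕ west , λ _ u∈R adj → only-z u∈R (p-neighbours (suc i) u∈R adj)
      where
      only-z : ∀ {u} → u ∈ R → _ → OnPath (suc k) p q u ⊎ u ≡ p (suc i) ⊕ west
      only-z u∈R (inj₁ refl) = inj₁ (inj₂ (suc i , 1+i<k , p-north (suc i)))
      only-z u∈R (inj₂ (inj₁ refl)) = inj₁ (inj₂ (i , i<k , p-se i))
      only-z u∈R (inj₂ (inj₂ (inj₁ u≡))) = inj₂ u≡
      only-z u∈R (inj₂ (inj₂ (inj₂ (inj₁ refl)))) =
        ⊥-elim (no-triangle tf (p (suc i)) north nw (p∈R (s<s i<k))
          (subst (_∈ R) (sym (p-north (suc i))) (q∈R 1+i<k)) u∈R)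
      only-z u∈R (inj₂ (inj₂ (inj₂ (inj₂ refl)))) =
        ⊥-elim (no-triangle tf (p (suc i)) se south (p∈R (s<s i<k))
          (subst (_∈ R) (sym (p-se i)) (q∈R i<k)) u∈R)
    ... | no 1+i≮k = z , λ _ u∈R adj → only-z u∈R (p-neighbours (suc i) u∈R adj)
      where
      i≡k : suc i ≡ suc k
      i≡k = ≤-antisym i<k (≮⇒≥ 1+i≮k)
      z,only = at-most-one tf (p (suc i)) west nw (p∈R (s<s i<k))
      z = proj₁ z,only
      only-z : ∀ {u} → u ∈ R → _ → OnPath (suc k) p q u ⊎ u ≡ z
      only-z u∈R (inj₁ refl) = contradiction
        (subst (_∈ R) (trans (p-north (suc i)) (cong q i≡k)) u∈R) q∉R
      only-z u∈R (inj₂ (inj₁ refl)) = inj₁ (inj₂ (i , i<k , p-se i))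
      only-z u∈R (inj₂ (inj₂ (inj₁ u≡))) = inj₂ (proj₂ z,only u∈R (inj₁ u≡))
      only-z u∈R (inj₂ (inj₂ (inj₂ (inj₁ u≡)))) = inj₂ (proj₂ z,only u∈R (inj₂ u≡))
      only-z u∈R (inj₂ (inj₂ (inj₂ (inj₂ refl)))) =
        ⊥-elim (no-triangle tf (p (suc i)) se south (p∈R (s<s i<k))
          (subst (_∈ R) (sym (p-se i)) (q∈R i<k)) u∈R)

    zigzag-handle : Handle R
    zigzag-handle = record
      { k = suc k ; p = p ; q = q ; z = proj₁ ∘ p-off
      ; p∈R = p∈R ; q∈R = q∈R
      ; pp = λ {i} {j} _ _ → same-height⇒¬Adj (p i) (p j) (trans (height-p i) (sym (height-p j)))
      ; qq = λ {i} {j} _ _ → same-height⇒¬Adj (q i) (q j) (trans (height-q i) (sym (height-q j)))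
      ; pq = λ {i} {j} _ _ → p-q-index i j
      ; p-off = λ {i} i<k → proj₂ (p-off i) i<k
      ; q-off = q-off }

  -- The first coordinates of `q i` and `v` differ by `i`, while those of `v` and the vertices of
  -- `R` differ by at most `N`.
  q-leaves : ∃[ n ] q n ∉ R
  q-leaves = suc N , λ q∈R → <-irrefl refl (begin-strict
    N                                        <⟨ n<1+n N ⟩
    suc N                                    ≡⟨ ℤ.∣-i∣≡∣i∣ (+ suc N) ⟨
    ∣ ℤ.- + suc N ∣                          ≡⟨ cong ∣_∣ (eq (proj₁ v) (+ suc N)) ⟨
    ∣ proj₁ v ℤ.- + suc N ℤ.- proj₁ v ∣      ≡⟨ cong (λ x → ∣ x ℤ.- proj₁ v ∣) (x-q (suc N)) ⟨
    distance (q (suc N))                     ≤⟨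
      All.lookup (ℕExtrema.f[xs]≤f[argmax] {f = distance} v R) q∈R ⟩
    N                                        ∎)
    where
    open ≤-Reasoning
    eq : ∀ x i → x ℤ.- i ℤ.- x ≡ ℤ.- i
    eq = solve-∀
    distance : Vertex → ℕ
    distance u = ∣ proj₁ u ℤ.- proj₁ v ∣
    N = distance (ℕExtrema.argmax distance v R)

  handle : Handle R
  handle with least (λ i → q i ∉ᵥ? R) (proj₁ q-leaves) (proj₂ q-leaves)
  ... | zero  , q∉R , _   = contradiction v∈R q∉R
  ... | suc k , q∉R , min with anyUpTo? (λ i → p i ∉ᵥ? R) (suc (suc k))
  -- `p 0` is reached from `q 0` as its south neighbour, every later `p (suc i)` from `q i` as its
  -- nw neighbour. This includes `p (suc k)`, whose north neighbour is the gap.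
  ...   | yes (zero  , _         , p∉R) = missing-p 0 v∈R p∉R
  ...   | yes (suc i , s≤s i<k , p∉R) =
          missing-p-suc i (decidable-stable (q i ∈ᵥ? R) (min i<k)) p∉R
  ...   | no all-p = zigzag-handle k (λ i<k → decidable-stable (_ ∈ᵥ? R) (min i<k)) q∉R
                       (λ i≤k → decidable-stable (_ ∈ᵥ? R) λ p∉R → all-p (_ , i≤k , p∉R))

-- The starting vertex is a lexicographic maximum, found in two stages: greatest height first, then
-- greatest first coordinate on that level.
handle-exists : TriangleFree R → ∀ {v} → v ∈ R → Handle R
handle-exists {R} tf {v} v∈R = Zigzag.handle tf w w∈R
  (λ u∈R → ℤ.≤-trans (top-highest u∈R) (ℤ.≤-reflexive (sym h≡)))
  (λ u∈R h → All.lookup (f[xs]≤f[argmax] top level) (∈-filter⁺ level? u∈R (trans h h≡)))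
  where
  top = argmax height v R
  top∈R : top ∈ R
  top∈R = argmax-all height v∈R (All.tabulate id)
  top-highest : ∀ {u} → u ∈ R → height u ℤ.≤ height top
  top-highest = All.lookup (f[xs]≤f[argmax] v R)
  level? : Decidable (λ u → height u ≡ height top)
  level? u = height u ℤ.≟ height top
  level = filter level? R
  w = argmax proj₁ top level
  w∈level : w ∈ level
  w∈level = argmax-all proj₁ (∈-filter⁺ level? top∈R refl) (All.tabulate id)
  w∈R = proj₁ (∈-filter⁻ level? w∈level)
  h≡ = proj₂ (∈-filter⁻ level? {xs = R} w∈level)

-- Induction on the length of the vertex list, and the ratio in natural numbers

choosable : ∀ {b t} → b ≤ t + t → ∀ R → Acc _<_ (length R) → TriangleFree R →
  Choosable R (b + (b + t)) b
choosable b≤2t [] _ _ L _ = (λ _ → []) , (λ _ ()) , (λ _ _ ())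
choosable b≤2t R@(_ ∷ _) (acc rec) tf =
  extend b≤2t H (choosable b≤2t rest (rec rest-shorter)
    λ u∈ v∈ w∈ → tf (rest⊆R u∈) (rest⊆R v∈) (rest⊆R w∈))
  where
  H = handle-exists tf (here refl)
  open Handle H

-- From 4b ≤ 5b ≤ 2a comes a = 2b + t, and cancelling 4b in 5b ≤ 4b + 2t gives b ≤ 2t.
2a≥5b⇒a≡2b+t : ∀ {a b} → 2 * a ≥ 5 * b → ∃[ t ] b ≤ t + t × b + (b + t) ≡ a
2a≥5b⇒a≡2b+t {a} {b} 5b≤2a =
  let t , 2b+t≡a = m≤n⇒∃[o]m+o≡n {b + b} {a} (*-cancelˡ-≤ 2 (begin
        2 * (b + b)      ≤⟨ m≤m+n (2 * (b + b)) b ⟩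
        2 * (b + b) + b  ≡⟨ eq₁ b ⟩
        5 * b            ≤⟨ 5b≤2a ⟩
        2 * a            ∎))
  in t , +-cancelˡ-≤ (4 * b) _ _ (begin
        4 * b + b        ≡⟨ eq₂ b ⟩
        5 * b            ≤⟨ 5b≤2a ⟩
        2 * a            ≡⟨ cong (2 *_) 2b+t≡a ⟨
        2 * (b + b + t)  ≡⟨ eq₃ b t ⟩
        4 * b + (t + t)  ∎) , trans (sym (+-assoc b b t)) 2b+t≡a
  where
  open ≤-Reasoning
  eq₁ : ∀ b → 2 * (b + b) + b ≡ 5 * b
  eq₁ = ℕ.solve-∀
  eq₂ : ∀ b → 4 * b + b ≡ 5 * b
  eq₂ = ℕ.solve-∀
  eq₃ : ∀ b t → 2 * (b + b + t) ≡ 4 * b + (t + t)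
  eq₃ = ℕ.solve-∀

theorem4p4 : (R : List Vertex) → TriangleFree R →
    (a b : ℕ) → 1 ≤ a → 1 ≤ b → 2 * a ≥ 5 * b → Choosable R a b
theorem4p4 R tf a b _ _ 2a≥5b with 2a≥5b⇒a≡2b+t {a} {b} 2a≥5b
... | t , b≤2t , refl = choosable b≤2t R (<-wellFounded (length R)) tf
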